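{- Let $\Phi$ be a set of CHCs over $\Sigma_{BV}\cup\Pi$, let $\Delta_{BV}\subseteq\Phi$ and $\Delta_{IA}=\Phi\setminus\Delta_{BV}$, and let $E=(\Phi_{BV},\Phi_{IA},I)$ be the theory-modular encoding of $\Phi$ induced by $(\Delta_{BV},\Delta_{IA})$ (with respect to fixed domain transformers and a fixed theory transformer $\tau_{BV\to IA}$). Then $\Phi$ is satisfiable modulo $T_{BV}$ if and only if $E$ is satisfiable modulo $(T_{BV},T_{IA})$.
   Context: **Theories.** $\Sigma_{BV}$ is the many-sorted first-order signature of SMT-LIB fixed-size bit-vectors: a sort $BV_n$ for each $n\ge 1$; predicates: equality, unsigned and signed comparisons; functions: a constant for every bit-vector, and the usual arithmetic, bitwise, shift, extraction and concatenation operators. $\Sigma_{IA}$ is the signature of integer arithmetic: one sort $Int$, predicates $=,<,\le$, a constant for every integer, and $+,-,\cdot,\mathrm{div},\mathrm{mod}$. $T_{BV}$ and $T_{IA}$ are the corresponding SMT-LIB theories, with fixed standard models $M_{BV}$ (the domain of $BV_n$ is the finite set of all bit-vectors of width $n$) and $M_{IA}$ (domain $\mathbb{Z}$). Satisfiability and validity modulo $T_{BV}$ (resp. $T_{IA}$) are understood with respect to $M_{BV}$ (resp. $M_{IA}$). $QF_{BV}$, $QF_{IA}$ are the classes of quantifier-free formulas over $\Sigma_{BV}$, $\Sigma_{IA}$. For a formula $\varphi$ with free variables $\bar x$ and a structure $M$, $[\![\varphi]\!]_M$ is the set of value tuples for $\bar x$ satisfying $\varphi$ in $M$. For a predicate $p$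 or a tuple of variables $\bar x$, $D_p$, $D_{\bar x}$ denote the product of the domains of the corresponding bit-vector sorts in $M_{BV}$. **CHCs.** Let $\Pi$ be a set of fresh (uninterpreted) predicate symbols typed over the sorts of a signature $\Sigma$. A CHC over $\Sigma\cup\Pi$ is a sentence $\forall\bar x.\ (\phi[\bar x]\wedge\bigwedge_j p_j(\bar x_{p_j}))\to H$, where $\phi$ is a quantifier-free $\Sigma$-formula (the constraint) in which all variables of $\bar x$ appear, $p_j\in\Pi$ (repetitions allowed), $\bar x_{p_j}\subseteq\bar x$, and the head $H$ is either $h(\bar x_h)$ with $h\in\Pi$, $\bar x_h\subseteq\bar x$ (a rule), or $\bot$ (a query). The left-hand side is the body. **Semantics of a CHC set.** For a set $\Phi$ of CHCs over $\Sigma_{BV}\cup\Pi$, $p\in\Pi$, $n\in\mathbb{N}$, the bounded semantics $[\![p]\!]_{M_{BV}}^n$ is the union, over all rules $\forall\bar x.\,B[\bar x]\to p(\bar x_p)$ in $\Phi$, of the set of values of $\bar x_p$ under assignments satisfying $B$ in the expansion of $M_{BV}$ that interprets every $q\in\Pi$ as $\emptyset$ if $n=0$ and as $[\![q]\!]_{M_{BV}}^{n-1}$ if $n>0$. Set $[\![p]\!]_{M_{BV}}=\bigcup_n[\![p]\!]_{M_{BV}}^n$. $\Phi$ is satisfiable modulo $T_{BV}$ if every query of $\Phi$ is true in the expansion of $M_{BV}$ interpreting each $p\in\Pi$ as $[\![p]\!]_{M_{BV}}$. **Transformers.** A fixed bijection $x\mapsto x'$ maps bit-vector variables to integer variables.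 Each bit-vector variable $x$ of sort $BV_n$ has a domain transformer $\delta_x$, an injective map from the set of bit-vectors of width $n$ to $\mathbb{Z}$; it is required that all variables appearing in the same argument position of an uninterpreted predicate in $\Phi$ have the same domain transformer. $\delta_{\bar x}$ acts componentwise on tuples and elementwise on sets; $\delta_p=\delta_{\bar x_p}$ for any application $p(\bar x_p)$ in $\Phi$; $\delta^{ -1}$ denotes preimage. $\rho(x')$ is the $\Sigma_{IA}$-constraint (domain restriction) expressing that $x'$ lies in the image of $\delta_x$. A theory transformer from $T_{BV}$ to $T_{IA}$ is a function $\tau_{BV\to IA}$ mapping every $\varphi\in QF_{BV}$ with free variables $\bar x$ to some $\tau_{BV\to IA}(\varphi)\in QF_{IA}$ with free variables $\bar x'$ such that $[\![\varphi]\!]_{M_{BV}}=\delta_{\bar x}^{ -1}\big([\![\tau_{BV\to IA}(\varphi)]\!]_{M_{IA}}\cap\delta_{\bar x}(D_{\bar x})\big)$. **Theory-modular encoding.** Given $\Delta_{BV}\subseteq\Phi$, $\Delta_{IA}=\Phi\setminus\Delta_{BV}$, the encoding is $E=(\Phi_{BV},\Phi_{IA},I)$, where, with fresh copies $\Pi^{BV}=\{p^{BV}:p\in\Pi\}$ (same types) and $\Pi^{IA}=\{p^{IA}:p\in\Pi\}$ (all arguments of sort $Int$): - $\Phi_{BV}$ is obtained from $\Delta_{BV}$ by replacing each $p$ by $p^{BV}$. - $\Phi_{IA}$ is obtained from $\Delta_{IA}$ by replacing each CHC $\forall\bar x.\,(\phi\wedge\bigwedge_j p_j(\bar x_{p_j}))\to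 h(\bar x_h)$ by $\forall\bar x'.\,(\tau_{BV\to IA}(\phi)\wedge\bigwedge_j p_j^{IA}(\bar x'_{p_j})\wedge\bigwedge_{x\in\bar y}\rho(x'))\to h^{IA}(\bar x'_h)$, where $\bar y=\bar x\setminus\bigcup_j\bar x_{p_j}$; a head $\bot$ is left unchanged. - $I=I_{BV}\cup I_{IA}$: $I_{BV}$ consists of all pairs $(p^{BV},p^{IA})$ such that $p^{BV}$ is the head predicate of some CHC in $\Phi_{BV}$ and $p^{IA}$ occurs in the body of some CHC in $\Phi_{IA}$; $I_{IA}$ consists of all pairs $(p^{IA},p^{BV})$ such that $p^{IA}$ is the head predicate of some CHC in $\Phi_{IA}$ and $p^{BV}$ occurs in the body of some CHC in $\Phi_{BV}$. **Semantics of the encoding.** For $\{a,b\}=\{BV,IA\}$, $p^a\in\Pi^a$ and $n\in\mathbb{N}$, define by induction on $n$: $[\![p^a]\!]^n=L^n(p^a)\cup X^n(p^a)$. The local part $L^n(p^a)$ is the union, over all rules $\forall\bar x.\,B\to p^a(\bar x_{p^a})$ in $\Phi_a$, of the set of values of $\bar x_{p^a}$ under assignments satisfying $B$ in the expansion of $M_a$ interpreting every $q^a\in\Pi^a$ as $\emptyset$ if $n=0$ and as $[\![q^a]\!]^{n-1}$ if $n>0$. The external part $X^n(p^a)$ is $\emptyset$ if $n=0$ or $(p^b,p^a)\notin I$; otherwise it is $\delta_p([\![p^{BV}]\!]^{n-1})$ if $a=IA$, and $\delta_p^{ -1}([\![p^{IA}]\!]^{n-1})$ if $a=BV$. Set $[\![p^a]\!]=\bigcup_n[\![p^a]\!]^n$.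 $E$ is satisfiable modulo $(T_{BV},T_{IA})$ if for each $a\in\{BV,IA\}$, every query in $\Phi_a$ is true in the expansion of $M_a$ interpreting each $p^a\in\Pi^a$ as $[\![p^a]\!]$. -}

module Defs where

open import Data.Bool.Base using (Bool; true; false; not; if_then_else_; _∧_; _∨_; _xor_)
open import Data.Empty using (⊥)
open import Data.Integer.Base as ℤ using (ℤ)
open import Data.List.Base using (List; []; _∷_; _++_; map; foldr; concatMap; filter; deduplicate)
open import Data.List.Membership.Propositional using (_∈_)
open import Data.List.Relation.Binary.BagAndSetEquality using (_∼[_]_; set)
open import Data.List.Relation.Binary.Subset.Propositional using () renaming (_⊆_ to _⊆ˡ_)
open import Data.List.Relation.Unary.All as All using (All; []; _∷_)
open import Data.Maybe.Base as Maybe using (Maybe; just; nothing)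
open import Data.Nat.Base as ℕ using (ℕ; zero; suc)
import Data.Nat.Properties as ℕ
open import Data.Product.Base using (Σ; ∃; _×_; _,_; proj₁; proj₂)
open import Data.Product.Properties using (≡-dec)
open import Data.Sum.Base using (_⊎_)
open import Data.Unit.Base using (⊤; tt)
import Data.Unit.Properties as Unit
open import Data.Vec.Base as Vec using (Vec; []; _∷_)
import Data.Bool.Properties as Bool
import Data.Vec.Properties as Vec
open import Function.Base using (const; _∘_)
open import Function.Bundles using (_⇔_; _↔_; Inverse)
open import Function.Definitions using (Injective)
open import Level using (0ℓ)
open import Relation.Binary.Definitions using (DecidableEquality)
open import Relation.Binary.PropositionalEquality using (_≡_; _≗_)
open import Relation.Nullary.Decidable using (⌊_⌋; ¬?)
open import Relation.Nullary.Negation using (¬_)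
open import Relation.Unary using (Pred; _≐_; _∩_; _⊢_; U; ∅)

import Data.List.Membership.DecPropositional as DecMembership

-- Equality is one of the relation symbols of the signatures below.
record Signature : Set₁ where
  field
    Sort : Set
    _≟ˢ_ : DecidableEquality Sort
    Fun  : List Sort → Sort → Set
    Rel  : List Sort → Set

open Signature

record Structure (S : Signature) : Set₁ where
  field
    Dom : Sort S → Set
    funᴹ : ∀ {ss s} → Fun S ss s → All Dom ss → Dom s
    relᴹ : ∀ {ss} → Rel S ss → All Dom ss → Set

open Structure

-- A variable is a sort together with a name; each sort has countably many.
Var : Signature → Set
Var S = Sort S × ℕ

≟-Var : ∀ S → DecidableEquality (Var S)
≟-Var S = ≡-dec (_≟ˢ_ S) ℕ._≟_

-- A tuple of variables (names) of the given sorts.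
VarTuple : (S : Signature) → List (Sort S) → Set
VarTuple S ss = All (λ _ → ℕ) ss

varsOf : ∀ S {ss} → VarTuple S ss → List (Var S)
varsOf S              []       = []
varsOf S {ss = s ∷ _} (x ∷ xs) = (s , x) ∷ varsOf S xs

asTuple : ∀ S (xs : List (Var S)) → VarTuple S (map proj₁ xs)
asTuple S []             = []
asTuple S ((_ , x) ∷ xs) = x ∷ asTuple S xs

data Term (S : Signature) : Sort S → Set where
  var : ∀ {s} → ℕ → Term S s
  app : ∀ {ss s} → Fun S ss s → All (Term S) ss → Term S s

data QF (S : Signature) : Set where
  rel              : ∀ {ss} → Rel S ss → All (Term S) ss → QF S
  ⊤′ ⊥′            : QF S
  ¬′_              : QF S → QF S
  _∧′_ _∨′_ _⇒′_ _⇔′_ : QF S → QF S → QF S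

⋀ : ∀ {S} → List (QF S) → QF S
⋀ = foldr _∧′_ ⊤′

module _ {S : Signature} where

  mutual
    occᵗ : ∀ {s} → Term S s → List (Var S)
    occᵗ {s} (var x)    = (s , x) ∷ []
    occᵗ     (app f ts) = occᵗˢ ts

    occᵗˢ : ∀ {ss} → All (Term S) ss → List (Var S)
    occᵗˢ []       = []
    occᵗˢ (t ∷ ts) = occᵗ t ++ occᵗˢ ts

  occ : QF S → List (Var S)
  occ (rel r ts) = occᵗˢ ts
  occ ⊤′         = []
  occ ⊥′         = []
  occ (¬′ φ)     = occ φ
  occ (φ ∧′ ψ)   = occ φ ++ occ ψ
  occ (φ ∨′ ψ)   = occ φ ++ occ ψ
  occ (φ ⇒′ ψ)   = occ φ ++ occ ψ
  occ (φ ⇔′ ψ)   = occ φ ++ occ ψ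

  fv : QF S → List (Var S)
  fv φ = deduplicate (≟-Var S) (occ φ)

  module _ (M : Structure S) where

    Assignment : Set
    Assignment = (x : Var S) → Dom M (proj₁ x)

    Tuple : List (Sort S) → Set
    Tuple ss = All (Dom M) ss

    valuesAt : ∀ {ss} → Assignment → VarTuple S ss → Tuple ss
    valuesAt              α []       = []
    valuesAt {ss = s ∷ _} α (x ∷ xs) = α (s , x) ∷ valuesAt α xs

    mutual
      evalᵗ : ∀ {s} → Assignment → Term S s → Dom M s
      evalᵗ {s} α (var x)    = α (s , x)
      evalᵗ     α (app f ts) = funᴹ M f (evalᵗˢ α ts)

      evalᵗˢ : ∀ {ss} → Assignment → All (Term S) ss → Tuple ss
      evalᵗˢ α []       = []
      evalᵗˢ α (t ∷ ts) = evalᵗ α t ∷ evalᵗˢ α ts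

    Holds : Assignment → QF S → Set
    Holds α (rel r ts) = relᴹ M r (evalᵗˢ α ts)
    Holds α ⊤′         = ⊤
    Holds α ⊥′         = ⊥
    Holds α (¬′ φ)     = ¬ Holds α φ
    Holds α (φ ∧′ ψ)   = Holds α φ × Holds α ψ
    Holds α (φ ∨′ ψ)   = Holds α φ ⊎ Holds α ψ
    Holds α (φ ⇒′ ψ)   = Holds α φ → Holds α ψ
    Holds α (φ ⇔′ ψ)   = Holds α φ ⇔ Holds α ψ

    ⟦_⟧[_] : ∀ {ss} → QF S → VarTuple S ss → Pred (Tuple ss) 0ℓ
    ⟦ φ ⟧[ xs ] v = Σ Assignment λ α → Holds α φ × valuesAt α xs ≡ v

-- Bit i is the entry at index i, so the least significant bit comes first.
BitVec : ℕ → Set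
BitVec = Vec Bool

-- The operations follow the SMT-LIB theory FixedSizeBitVectors and the
-- abbreviations of the logic QF_BV, including their values at divisor 0.
module BitVector where

  bv2nat : ∀ {n} → BitVec n → ℕ
  bv2nat []       = 0
  bv2nat (b ∷ bs) = (if b then 1 else 0) ℕ.+ 2 ℕ.* bv2nat bs

  -- Reduces modulo 2ⁿ.
  nat2bv : ∀ n → ℕ → BitVec n
  nat2bv zero    m = []
  nat2bv (suc n) m = (m ℕ.% 2 ℕ.≡ᵇ 1) ∷ nat2bv n (m ℕ./ 2)

  _≡ᵇᵛ_ : ∀ {n} → BitVec n → BitVec n → Bool
  s ≡ᵇᵛ t = ⌊ Vec.≡-dec Bool._≟_ s t ⌋

  msb : ∀ {n} → BitVec (suc n) → Bool
  msb = Vec.last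

  bvnot : ∀ {n} → BitVec n → BitVec n
  bvnot = Vec.map not

  bitwise : ∀ {n} → (Bool → Bool → Bool) → BitVec n → BitVec n → BitVec n
  bitwise = Vec.zipWith

  bvneg : ∀ {n} → BitVec n → BitVec n
  bvneg {n} s = nat2bv n (2 ℕ.^ n ℕ.∸ bv2nat s)

  bvadd bvsub bvmul bvudiv bvurem : ∀ {n} → BitVec n → BitVec n → BitVec n
  bvadd {n} s t = nat2bv n (bv2nat s ℕ.+ bv2nat t)
  bvsub     s t = bvadd s (bvneg t)
  bvmul {n} s t = nat2bv n (bv2nat s ℕ.* bv2nat t)
  bvudiv {n} s t with bv2nat t
  ... | zero      = Vec.replicate n true
  ... | d@(suc _) = nat2bv n (bv2nat s ℕ./ d)
  bvurem {n} s t with bv2nat t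
  ... | zero      = s
  ... | d@(suc _) = nat2bv n (bv2nat s ℕ.% d)

  bvsdiv bvsrem bvsmod : ∀ {n} → BitVec (suc n) → BitVec (suc n) → BitVec (suc n)
  bvsdiv s t with msb s | msb t
  ... | false | false = bvudiv s t
  ... | true  | false = bvneg (bvudiv (bvneg s) t)
  ... | false | true  = bvneg (bvudiv s (bvneg t))
  ... | true  | true  = bvudiv (bvneg s) (bvneg t)
  bvsrem s t with msb s | msb t
  ... | false | false = bvurem s t
  ... | true  | false = bvneg (bvurem (bvneg s) t)
  ... | false | true  = bvurem s (bvneg t)
  ... | true  | true  = bvneg (bvurem (bvneg s) (bvneg t))
  bvsmod {n} s t = if u ≡ᵇᵛ Vec.replicate (suc n) false then u else adjust (msb s) (msb t)
    where
    abs : BitVec (suc n) → BitVec (suc n)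
    abs w = if msb w then bvneg w else w
    u : BitVec (suc n)
    u = bvurem (abs s) (abs t)
    adjust : Bool → Bool → BitVec (suc n)
    adjust false false = u
    adjust true  false = bvadd (bvneg u) t
    adjust false true  = bvadd u t
    adjust true  true  = bvneg u

  shiftRight : ∀ m {n} → BitVec n → ℕ → BitVec m
  shiftRight m s k = nat2bv m (ℕ._/_ (bv2nat s) (2 ℕ.^ k) {{ℕ.m^n≢0 2 k}})

  bvshl bvlshr : ∀ {n} → BitVec n → BitVec n → BitVec n
  bvshl  {n} s t = nat2bv n (bv2nat s ℕ.* 2 ℕ.^ bv2nat t)
  bvlshr {n} s t = shiftRight n s (bv2nat t)

  bvashr : ∀ {n} → BitVec (suc n) → BitVec (suc n) → BitVec (suc n)
  bvashr s t = if msb s then bvnot (bvlshr (bvnot s) t) else bvlshr s t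

  iterate : ∀ {A : Set} → ℕ → (A → A) → A → A
  iterate zero    f a = a
  iterate (suc k) f a = iterate k f (f a)

  rotateLeft rotateRight : ∀ {n} → ℕ → BitVec (suc n) → BitVec (suc n)
  rotateLeft  k = iterate k (λ s → Vec.last s ∷ Vec.init s)
  rotateRight k = iterate k (λ s → Vec.tail s Vec.∷ʳ Vec.head s)

  _<ᵘ_ _≤ᵘ_ : ∀ {n} → BitVec n → BitVec n → Set
  s <ᵘ t = bv2nat s ℕ.< bv2nat t
  s ≤ᵘ t = bv2nat s ℕ.≤ bv2nat t

  _<ˢ_ _≤ˢ_ : ∀ {n} → BitVec (suc n) → BitVec (suc n) → Set
  s <ˢ t = (msb s ≡ true × msb t ≡ false) ⊎ (msb s ≡ msb t × s <ᵘ t)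
  s ≤ˢ t = (msb s ≡ true × msb t ≡ false) ⊎ (msb s ≡ msb t × s ≤ᵘ t)

open BitVector

-- The number n stands for the sort of bit-vectors of width 1 + n, so that
-- exactly the positive widths occur.
BVSort : Set
BVSort = ℕ

data BVFun : List BVSort → BVSort → Set where
  const′ : ∀ {n} → BitVec (suc n) → BVFun [] n
  bvnot′ bvneg′ : ∀ {n} → BVFun (n ∷ []) n
  bvand′ bvor′ bvxor′ bvnand′ bvnor′ bvxnor′ : ∀ {n} → BVFun (n ∷ n ∷ []) n
  bvadd′ bvsub′ bvmul′ bvudiv′ bvurem′ bvsdiv′ bvsrem′ bvsmod′ : ∀ {n} → BVFun (n ∷ n ∷ []) n
  bvshl′ bvlshr′ bvashr′ : ∀ {n} → BVFun (n ∷ n ∷ []) n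
  bvcomp′ : ∀ {n} → BVFun (n ∷ n ∷ []) 0
  -- ((_ extract i j) s) consists of the bits i, …, j of s.
  extract′ : ∀ {n} (i j : ℕ) → .(j ℕ.≤ i) → .(i ℕ.≤ n) → BVFun (n ∷ []) (i ℕ.∸ j)
  concat′ : ∀ {m n} → BVFun (m ∷ n ∷ []) (n ℕ.+ suc m)
  -- repeat′ j concatenates 1 + j copies.
  repeat′ : ∀ {n} (j : ℕ) → BVFun (n ∷ []) (n ℕ.+ j ℕ.* suc n)
  zero-extend′ sign-extend′ : ∀ {n} (k : ℕ) → BVFun (n ∷ []) (n ℕ.+ k)
  rotate-left′ rotate-right′ : ∀ {n} (k : ℕ) → BVFun (n ∷ []) n

data BVRel : List BVSort → Set where
  eq′ : ∀ {n} → BVRel (n ∷ n ∷ [])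
  bvult′ bvule′ bvugt′ bvuge′ : ∀ {n} → BVRel (n ∷ n ∷ [])
  bvslt′ bvsle′ bvsgt′ bvsge′ : ∀ {n} → BVRel (n ∷ n ∷ [])

Σ-BV : Signature
Σ-BV = record { Sort = BVSort ; _≟ˢ_ = ℕ._≟_ ; Fun = BVFun ; Rel = BVRel }

M-BV : Structure Σ-BV
M-BV = record { Dom = D ; funᴹ = fun ; relᴹ = relation }
  where
  D : BVSort → Set
  D n = BitVec (suc n)

  fun : ∀ {ss s} → BVFun ss s → All D ss → D s
  fun (const′ c)               []           = c
  fun bvnot′                   (s ∷ [])     = bvnot s
  fun bvneg′                   (s ∷ [])     = bvneg s
  fun bvand′                   (s ∷ t ∷ []) = bitwise _∧_ s t
  fun bvor′                    (s ∷ t ∷ []) = bitwise _∨_ s t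
  fun bvxor′                   (s ∷ t ∷ []) = bitwise _xor_ s t
  fun bvnand′                  (s ∷ t ∷ []) = bvnot (bitwise _∧_ s t)
  fun bvnor′                   (s ∷ t ∷ []) = bvnot (bitwise _∨_ s t)
  fun bvxnor′                  (s ∷ t ∷ []) = bvnot (bitwise _xor_ s t)
  fun bvadd′                   (s ∷ t ∷ []) = bvadd s t
  fun bvsub′                   (s ∷ t ∷ []) = bvsub s t
  fun bvmul′                   (s ∷ t ∷ []) = bvmul s t
  fun bvudiv′                  (s ∷ t ∷ []) = bvudiv s t
  fun bvurem′                  (s ∷ t ∷ []) = bvurem s t
  fun bvsdiv′                  (s ∷ t ∷ []) = bvsdiv s t
  fun bvsrem′                  (s ∷ t ∷ []) = bvsrem s t
  fun bvsmod′                  (s ∷ t ∷ []) = bvsmod s t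
  fun bvshl′                   (s ∷ t ∷ []) = bvshl s t
  fun bvlshr′                  (s ∷ t ∷ []) = bvlshr s t
  fun bvashr′                  (s ∷ t ∷ []) = bvashr s t
  fun bvcomp′                  (s ∷ t ∷ []) = (s ≡ᵇᵛ t) ∷ []
  fun (extract′ i j j≤i i≤n)   (s ∷ [])     = shiftRight (suc (i ℕ.∸ j)) s j
  fun concat′                  (s ∷ t ∷ []) = t Vec.++ s
  fun (repeat′ j)              (s ∷ [])     = Vec.concat (Vec.replicate (suc j) s)
  fun (zero-extend′ k)         (s ∷ [])     = s Vec.++ Vec.replicate k false
  fun (sign-extend′ k)         (s ∷ [])     = s Vec.++ Vec.replicate k (msb s)
  fun (rotate-left′ k)         (s ∷ [])     = rotateLeft k s
  fun (rotate-right′ k)        (s ∷ [])     = rotateRight k s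

  relation : ∀ {ss} → BVRel ss → All D ss → Set
  relation eq′    (s ∷ t ∷ []) = s ≡ t
  relation bvult′ (s ∷ t ∷ []) = s <ᵘ t
  relation bvule′ (s ∷ t ∷ []) = s ≤ᵘ t
  relation bvugt′ (s ∷ t ∷ []) = t <ᵘ s
  relation bvuge′ (s ∷ t ∷ []) = t ≤ᵘ s
  relation bvslt′ (s ∷ t ∷ []) = s <ˢ t
  relation bvsle′ (s ∷ t ∷ []) = s ≤ˢ t
  relation bvsgt′ (s ∷ t ∷ []) = t <ˢ s
  relation bvsge′ (s ∷ t ∷ []) = t ≤ˢ s

IASort : Set
IASort = ⊤

pattern int = tt

data IAFun : List IASort → IASort → Set where
  const′ : ℤ → IAFun [] int
  neg′   : IAFun (int ∷ []) int
  add′ sub′ mul′ div′ mod′ : IAFun (int ∷ int ∷ []) int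

data IARel : List IASort → Set where
  eq′ lt′ le′ : IARel (int ∷ int ∷ [])

Σ-IA : Signature
Σ-IA = record { Sort = IASort ; _≟ˢ_ = Unit._≟_ ; Fun = IAFun ; Rel = IARel }

-- SMT-LIB leaves the values of div and mod at divisor 0 unspecified; a
-- standard model fixes them by arbitrary functions of the dividend.
record DivisionByZero : Set where
  field
    div₀ mod₀ : ℤ → ℤ

-- For divisors other than 0, SMT-LIB's div and mod are Euclidean (the
-- remainder is nonnegative), as are the library's _/_ and _%_.
module _ (Z : DivisionByZero) where
  open DivisionByZero Z

  divᶻ modᶻ : ℤ → ℤ → ℤ
  divᶻ i (ℤ.+ zero)       = div₀ i
  divᶻ i j@(ℤ.+[1+ _ ])   = i ℤ./ j
  divᶻ i j@(ℤ.-[1+ _ ])   = i ℤ./ j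
  modᶻ i (ℤ.+ zero)       = mod₀ i
  modᶻ i j@(ℤ.+[1+ _ ])   = ℤ.+ (i ℤ.% j)
  modᶻ i j@(ℤ.-[1+ _ ])   = ℤ.+ (i ℤ.% j)

  M-IA : Structure Σ-IA
  M-IA = record { Dom = const ℤ ; funᴹ = fun ; relᴹ = relation }
    where
    fun : ∀ {ss s} → IAFun ss s → All (const ℤ) ss → ℤ
    fun (const′ c) []           = c
    fun neg′       (i ∷ [])     = ℤ.- i
    fun add′       (i ∷ j ∷ []) = i ℤ.+ j
    fun sub′       (i ∷ j ∷ []) = i ℤ.- j
    fun mul′       (i ∷ j ∷ []) = i ℤ.* j
    fun div′       (i ∷ j ∷ []) = divᶻ i j
    fun mod′       (i ∷ j ∷ []) = modᶻ i j

    relation : ∀ {ss} → IARel ss → All (const ℤ) ss → Set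
    relation eq′ (i ∷ j ∷ []) = i ≡ j
    relation lt′ (i ∷ j ∷ []) = i ℤ.< j
    relation le′ (i ∷ j ∷ []) = i ℤ.≤ j

record PredSymbols (S : Signature) : Set₁ where
  field
    Symbol : Set
    arity  : Symbol → List (Sort S)

open PredSymbols

record Atom (S : Signature) (Π : PredSymbols S) : Set where
  constructor _·_
  field
    pred : Symbol Π
    args : VarTuple S (arity Π pred)

open Atom

-- ∀ vars. (constraint ∧ ⋀ body) → head, where the head nothing stands for ⊥.
record Clause (S : Signature) (Π : PredSymbols S) : Set where
  constructor clause
  field
    vars       : List (Var S)
    constraint : QF S
    body       : List (Atom S Π)
    head       : Maybe (Atom S Π)

open Clause

ClauseSet : (S : Signature) → PredSymbols S → Set₁
ClauseSet S Π = Pred (Clause S Π) 0ℓ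

module _ {S : Signature} {Π : PredSymbols S} where

  record IsCHC (c : Clause S Π) : Set where
    field
      constraint-vars : vars c ∼[ set ] fv (constraint c)
      body-vars       : ∀ {A} → A ∈ body c → varsOf S (args A) ⊆ˡ vars c
      head-vars       : ∀ {A} → head c ≡ just A → varsOf S (args A) ⊆ˡ vars c

  IsHeadPredicateIn : Symbol Π → ClauseSet S Π → Set
  IsHeadPredicateIn p Φ = ∃ λ c → Φ c × ∃ λ xs → head c ≡ just (p · xs)

  OccursInBodyIn : Symbol Π → ClauseSet S Π → Set
  OccursInBodyIn p Φ = ∃ λ c → Φ c × ∃ λ xs → (p · xs) ∈ body c

  ApplicationIn : Atom S Π → ClauseSet S Π → Set
  ApplicationIn A Φ = ∃ λ c → Φ c × (A ∈ body c ⊎ head c ≡ just A)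

  module _ (M : Structure S) where

    Interpretation : Set₁
    Interpretation = (p : Symbol Π) → Pred (Tuple M (arity Π p)) 0ℓ

    AtomHolds : Interpretation → Assignment M → Atom S Π → Set
    AtomHolds J α A = J (pred A) (valuesAt M α (args A))

    BodyHolds : Interpretation → Assignment M → Clause S Π → Set
    BodyHolds J α c = Holds M α (constraint c) × All (AtomHolds J α) (body c)

    -- The values derived by one application of the rules of Φ when the
    -- predicates in the bodies are interpreted by J.
    consequences : ClauseSet S Π → Interpretation → Interpretation
    consequences Φ J p v =
      ∃ λ c → Φ c × ∃ λ xs → head c ≡ just (p · xs) ×
      Σ (Assignment M) λ α → BodyHolds J α c × valuesAt M α xs ≡ v

    QueriesTrue : ClauseSet S Π → Interpretation → Set
    QueriesTrue Φ J = ∀ c → Φ c → head c ≡ nothing → ∀ α → ¬ BodyHolds J α c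

    boundedSemantics : ClauseSet S Π → ℕ → Interpretation
    boundedSemantics Φ zero    = consequences Φ (λ _ → ∅)
    boundedSemantics Φ (suc n) = consequences Φ (boundedSemantics Φ n)

    semantics : ClauseSet S Π → Interpretation
    semantics Φ p v = ∃ λ n → boundedSemantics Φ n p v

    Satisfiable : ClauseSet S Π → Set
    Satisfiable Φ = QueriesTrue Φ (semantics Φ)

Image : ∀ {A B : Set} → (A → B) → Pred A 0ℓ → Pred B 0ℓ
Image f P b = ∃ λ a → P a × f a ≡ b

ints : ∀ {A : Set} → List A → List IASort
ints = map (const int)

record DomainTransformers : Set where
  field
    prime       : Var Σ-BV ↔ Var Σ-IA
    δ           : (x : Var Σ-BV) → Dom M-BV (proj₁ x) → ℤ
    δ-injective : ∀ x → Injective _≡_ _≡_ (δ x)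

  _′ : Var Σ-BV → Var Σ-IA
  _′ = Inverse.to prime

  _′ᵗ : ∀ {ss} → VarTuple Σ-BV ss → VarTuple Σ-IA (ints ss)
  _′ᵗ              []       = []
  _′ᵗ {ss = s ∷ _} (x ∷ xs) = proj₂ ((s , x) ′) ∷ (xs ′ᵗ)

  δᵗ : ∀ {ss} → VarTuple Σ-BV ss → All (Dom M-BV) ss → All (const ℤ) (ints ss)
  δᵗ              []       []       = []
  δᵗ {ss = s ∷ _} (x ∷ xs) (b ∷ bs) = δ (s , x) b ∷ δᵗ xs bs

  CompatibleWith : ∀ {Π} → ClauseSet Σ-BV Π → Set
  CompatibleWith {Π} Φ =
    ∀ p (xs ys : VarTuple Σ-BV (arity Π p)) →
    ApplicationIn (p · xs) Φ → ApplicationIn (p · ys) Φ →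
    ∀ {s} (i : s ∈ arity Π p) → δ (s , All.lookup xs i) ≗ δ (s , All.lookup ys i)

  -- δ_p is δᵗ xs for any application p(xs) in Φ. It does not depend on the
  -- application if the transformers are compatible with Φ; if p does not
  -- occur in Φ, the two sets below are empty.
  module _ {Π} (Φ : ClauseSet Σ-BV Π) (p : Symbol Π) where

    δₚ-image : Pred (All (Dom M-BV) (arity Π p)) 0ℓ → Pred (All (const ℤ) (ints (arity Π p))) 0ℓ
    δₚ-image P w = ∃ λ xs → ApplicationIn (p · xs) Φ × Image (δᵗ xs) P w

    δₚ-preimage : Pred (All (const ℤ) (ints (arity Π p))) 0ℓ → Pred (All (Dom M-BV) (arity Π p)) 0ℓ
    δₚ-preimage Q v = ∃ λ xs → ApplicationIn (p · xs) Φ × (δᵗ xs ⊢ Q) v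

module _ (Z : DivisionByZero) (𝒟 : DomainTransformers) where
  open DomainTransformers 𝒟

  -- ρ x is the constraint written ρ(x′).
  record DomainRestrictions : Set where
    field
      ρ         : Var Σ-BV → QF Σ-IA
      ρ-fv      : ∀ x → fv (ρ x) ⊆ˡ (x ′) ∷ []
      ρ-correct : ∀ x (σ : Assignment (M-IA Z)) → Holds (M-IA Z) σ (ρ x) ⇔ Image (δ x) U (σ (x ′))

  record TheoryTransformer : Set where
    field
      τ         : QF Σ-BV → QF Σ-IA
      τ-fv      : ∀ φ → fv (τ φ) ∼[ set ] map _′ (fv φ)
      τ-correct : ∀ φ → let xs = asTuple Σ-BV (fv φ) in
        ⟦_⟧[_] M-BV φ xs ≐ δᵗ xs ⊢ (⟦_⟧[_] (M-IA Z) (τ φ) (xs ′ᵗ) ∩ Image (δᵗ xs) U)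

data Theory : Set where
  BV IA : Theory

sig : Theory → Signature
sig BV = Σ-BV
sig IA = Σ-IA

model : DivisionByZero → (a : Theory) → Structure (sig a)
model Z BV = M-BV
model Z IA = M-IA Z

-- The fresh copy pᵃ of a predicate symbol p.
record Copy (P : Set) (a : Theory) : Set where
  constructor copy
  field
    original : P

open Copy

copies : PredSymbols Σ-BV → (a : Theory) → PredSymbols (sig a)
copies Π BV = record { Symbol = Copy (Symbol Π) BV ; arity = arity Π ∘ original }
copies Π IA = record { Symbol = Copy (Symbol Π) IA ; arity = ints ∘ arity Π ∘ original }

record Encoding (Π : PredSymbols Σ-BV) : Set₁ where
  field
    clauses : (a : Theory) → ClauseSet (sig a) (copies Π a)
    -- interaction pᵃ pᵇ means (pᵃ, pᵇ) ∈ I.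
    interaction : ∀ {a b} → Copy (Symbol Π) a → Copy (Symbol Π) b → Set

module _ {Π : PredSymbols Σ-BV} where

  renameAtom : Atom Σ-BV Π → Atom Σ-BV (copies Π BV)
  renameAtom (p · xs) = copy p · xs

  renameClause : Clause Σ-BV Π → Clause Σ-BV (copies Π BV)
  renameClause (clause xs φ B H) = clause xs φ (map renameAtom B) (Maybe.map renameAtom H)

  nonBodyVars : List (Var Σ-BV) → List (Atom Σ-BV Π) → List (Var Σ-BV)
  nonBodyVars xs B = filter (λ x → ¬? (x ∈? concatMap (varsOf Σ-BV ∘ args) B)) xs
    where open DecMembership (≟-Var Σ-BV) using (_∈?_)

  module _ {Z : DivisionByZero} (𝒟 : DomainTransformers)
           (ℛ : DomainRestrictions Z 𝒟) (𝒯 : TheoryTransformer Z 𝒟) where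
    open DomainTransformers 𝒟
    open DomainRestrictions ℛ
    open TheoryTransformer 𝒯

    translateAtom : Atom Σ-BV Π → Atom Σ-IA (copies Π IA)
    translateAtom (p · xs) = copy p · (xs ′ᵗ)

    translateClause : Clause Σ-BV Π → Clause Σ-IA (copies Π IA)
    translateClause (clause xs φ B H) =
      clause (map _′ xs) (τ φ ∧′ ⋀ (map ρ (nonBodyVars xs B)))
             (map translateAtom B) (Maybe.map translateAtom H)

    module _ (Δ-BV Δ-IA : ClauseSet Σ-BV Π) where

      encodedClauses : (a : Theory) → ClauseSet (sig a) (copies Π a)
      encodedClauses BV = Image renameClause Δ-BV
      encodedClauses IA = Image translateClause Δ-IA

      data EncodedInteraction : ∀ {a b} → Copy (Symbol Π) a → Copy (Symbol Π) b → Set where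
        I-BV : ∀ p → IsHeadPredicateIn (copy p) (encodedClauses BV) →
               OccursInBodyIn (copy p) (encodedClauses IA) →
               EncodedInteraction {BV} {IA} (copy p) (copy p)
        I-IA : ∀ p → IsHeadPredicateIn (copy p) (encodedClauses IA) →
               OccursInBodyIn (copy p) (encodedClauses BV) →
               EncodedInteraction {IA} {BV} (copy p) (copy p)

    -- The encoding induced by (Δ, Φ ∖ Δ).
    encode : (Φ Δ : ClauseSet Σ-BV Π) → Encoding Π
    encode Φ Δ = record
      { clauses     = encodedClauses Δ Δ-IA
      ; interaction = EncodedInteraction Δ Δ-IA
      }
      where
      Δ-IA : ClauseSet Σ-BV Π
      Δ-IA c = Φ c × ¬ Δ c

  -- Φ is the clause set from which δ_p is determined.
  module _ (Z : DivisionByZero) (𝒟 : DomainTransformers)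
           (Φ : ClauseSet Σ-BV Π) (E : Encoding Π) where
    open DomainTransformers 𝒟
    open Encoding E

    mutual
      boundedᴱ : ℕ → (a : Theory) → Interpretation {Π = copies Π a} (model Z a)
      boundedᴱ n a p v = local n a p v ⊎ external n a p v

      local : ℕ → (a : Theory) → Interpretation {Π = copies Π a} (model Z a)
      local zero    a = consequences (model Z a) (clauses a) (λ _ → ∅)
      local (suc n) a = consequences (model Z a) (clauses a) (boundedᴱ n a)

      external : ℕ → (a : Theory) → Interpretation {Π = copies Π a} (model Z a)
      external zero    a  p        = ∅
      external (suc n) BV (copy p) v =
        interaction {IA} {BV} (copy p) (copy p) × δₚ-preimage Φ p (boundedᴱ n IA (copy p)) v
      external (suc n) IA (copy p) w =
        interaction {BV} {IA} (copy p) (copy p) × δₚ-image Φ p (boundedᴱ n BV (copy p)) w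

    semanticsᴱ : (a : Theory) → Interpretation {Π = copies Π a} (model Z a)
    semanticsᴱ a p v = ∃ λ n → boundedᴱ n a p v

    Satisfiableᴱ : Set
    Satisfiableᴱ = ∀ a → QueriesTrue (model Z a) (clauses a) (semanticsᴱ a)

{-# OPTIONS --safe #-}
-- Derivations of Φ and of E are translated into each other rule by rule.
-- Every value derived in E stands for a value derived in Φ: an integer solution
-- of a translated body lies in the image of the domain transformers, because
-- each of its variables is bounded either by a body atom or by ρ.  Conversely,
-- a value derived for p in Φ is derived in each theory in which p occurs in a
-- body: if the last rule was assigned to the other theory, then p is by
-- definition of I passed on.  As Δ need not be decidable, this second direction
-- holds up to double negation only, which suffices to refute query bodies.
module Submission where

open import Defs
open import Function.Bundles using (_⇔_)
open import Relation.Unary using (_⊆_)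

open import Data.Bool.Base using (false)
open import Data.List.Base using (List; []; _∷_; _++_; map; concatMap)
open import Data.List.Membership.Propositional using (_∈_; find)
open import Data.List.Membership.Propositional.Properties using (∈-++⁺ˡ; ∈-++⁺ʳ; ∈-map⁺; ∈-map⁻; ∈-concatMap⁻; ∈-filter⁺; ∈-deduplicate⁺)
open import Data.List.Relation.Unary.All as All using (All; []; _∷_)
import Data.List.Relation.Unary.All.Properties as All
open import Data.List.Relation.Unary.Any using (here; there)
open import Data.Maybe.Base as Maybe using (Maybe; just; nothing)
open import Data.Nat.Base using (ℕ; zero; suc; _≤_; _⊔_; _≤′_; ≤′-refl; ≤′-step)
open import Data.Nat.Properties using (m≤m⊔n; m≤n⊔m; ≤⇒≤′)
open import Data.Product.Base using (Σ; ∃; _×_; _,_; proj₁; proj₂)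
open import Data.Sum.Base using (inj₁; inj₂)
open import Data.Unit.Base using (tt)
open import Data.Vec.Base using (replicate)
open import Function.Base using (_∘_; id)
open import Function.Bundles using (Equivalence; Inverse; mk⇔)
open import Level using (0ℓ)
open import Relation.Binary.PropositionalEquality using (_≡_; refl; sym; trans; cong; cong₂; subst)
open import Relation.Nullary.Decidable using (Dec; yes; no; ¬¬-excluded-middle)
open import Relation.Nullary.Negation using (¬_; contradiction)
open import Relation.Unary using (Pred; U; ∅)
import Data.List.Membership.DecPropositional as DecMembership

open Structure
open Atom
open Clause

-- Double negation, optional heads and tuples of variables

¬¬-All : ∀ {A : Set} {P : Pred A 0ℓ} {xs} → All (λ x → ¬ ¬ P x) xs → ¬ ¬ All P xs
¬¬-All []       k = k []
¬¬-All (p ∷ ps) k = p λ px → ¬¬-All ps λ pxs → k (px ∷ pxs)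

map-nothing⁻ : ∀ {A B : Set} {f : A → B} (H : Maybe A) → Maybe.map f H ≡ nothing → H ≡ nothing
map-nothing⁻ nothing refl = refl

varsOf-asTuple : ∀ S xs → varsOf S (asTuple S xs) ≡ xs
varsOf-asTuple S []       = refl
varsOf-asTuple S (x ∷ xs) = cong (x ∷_) (varsOf-asTuple S xs)

-- Formulas and assignments

module _ {S : Signature} (M : Structure S) where

  AgreeOn : List (Var S) → Assignment M → Assignment M → Set
  AgreeOn xs α β = ∀ {x} → x ∈ xs → α x ≡ β x

  mutual
    evalᵗ-cong : ∀ {α β s} (t : Term S s) → AgreeOn (occᵗ t) α β → evalᵗ M α t ≡ evalᵗ M β t
    evalᵗ-cong (var x)    eq = eq (here refl)
    evalᵗ-cong (app f ts) eq = cong (funᴹ M f) (evalᵗˢ-cong ts eq)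

    evalᵗˢ-cong : ∀ {α β ss} (ts : All (Term S) ss) → AgreeOn (occᵗˢ ts) α β → evalᵗˢ M α ts ≡ evalᵗˢ M β ts
    evalᵗˢ-cong []       eq = refl
    evalᵗˢ-cong (t ∷ ts) eq =
      cong₂ _∷_ (evalᵗ-cong t (eq ∘ ∈-++⁺ˡ)) (evalᵗˢ-cong ts (eq ∘ ∈-++⁺ʳ (occᵗ t)))

  mutual
    Holds-cong-occ : ∀ {α β} φ → AgreeOn (occ φ) α β → Holds M α φ → Holds M β φ
    Holds-cong-occ (rel r ts) eq h        = subst (relᴹ M r) (evalᵗˢ-cong ts eq) h
    Holds-cong-occ ⊤′         eq h        = h
    -- Negation is contravariant, so the recursive call runs from `β` back to `α`.
    Holds-cong-occ (¬′ φ)     eq h        = h ∘ Holds-cong-occ φ (sym ∘ eq)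
    Holds-cong-occ (φ ∧′ ψ)   eq (h , k)  = Holds-congˡ φ ψ eq h , Holds-congʳ φ ψ eq k
    Holds-cong-occ (φ ∨′ ψ)   eq (inj₁ h) = inj₁ (Holds-congˡ φ ψ eq h)
    Holds-cong-occ (φ ∨′ ψ)   eq (inj₂ k) = inj₂ (Holds-congʳ φ ψ eq k)
    Holds-cong-occ (φ ⇒′ ψ)   eq h        = Holds-congʳ φ ψ eq ∘ h ∘ Holds-congˡ φ ψ (sym ∘ eq)
    Holds-cong-occ (φ ⇔′ ψ)   eq h        = mk⇔
      (Holds-congʳ φ ψ eq ∘ Equivalence.to h ∘ Holds-congˡ φ ψ (sym ∘ eq))
      (Holds-congˡ φ ψ eq ∘ Equivalence.from h ∘ Holds-congʳ φ ψ (sym ∘ eq))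

    Holds-congˡ : ∀ {α β} φ ψ → AgreeOn (occ φ ++ occ ψ) α β → Holds M α φ → Holds M β φ
    Holds-congˡ φ ψ eq = Holds-cong-occ φ (eq ∘ ∈-++⁺ˡ)

    Holds-congʳ : ∀ {α β} φ ψ → AgreeOn (occ φ ++ occ ψ) α β → Holds M α ψ → Holds M β ψ
    Holds-congʳ φ ψ eq = Holds-cong-occ ψ (eq ∘ ∈-++⁺ʳ (occ φ))

  Holds-cong : ∀ {α β} φ → AgreeOn (fv φ) α β → Holds M α φ → Holds M β φ
  Holds-cong φ eq = Holds-cong-occ φ (eq ∘ ∈-deduplicate⁺ (≟-Var S))

  valuesAt-agree : ∀ {α β ss} (xs : VarTuple S ss) → valuesAt M α xs ≡ valuesAt M β xs → AgreeOn (varsOf S xs) α β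
  valuesAt-agree (x ∷ xs) eq (here refl) = cong All.head eq
  valuesAt-agree (x ∷ xs) eq (there x∈)  = valuesAt-agree xs (cong All.tail eq) x∈

  Holds-⋀⁺ : ∀ {α} φs → All (Holds M α) φs → Holds M α (⋀ φs)
  Holds-⋀⁺ []       []       = tt
  Holds-⋀⁺ (φ ∷ φs) (h ∷ hs) = h , Holds-⋀⁺ φs hs

  Holds-⋀⁻ : ∀ {α} φs → Holds M α (⋀ φs) → All (Holds M α) φs
  Holds-⋀⁻ []       _        = []
  Holds-⋀⁻ (φ ∷ φs) (h , hs) = h ∷ Holds-⋀⁻ φs hs

-- Chains of interpretations

module _ {S : Signature} {Π : PredSymbols S} (M : Structure S) where

  _⊑_ : Interpretation {Π = Π} M → Interpretation {Π = Π} M → Set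
  J ⊑ K = ∀ p → J p ⊆ K p

  BodyHolds-mono : ∀ J K → J ⊑ K → ∀ {α} c → BodyHolds M J α c → BodyHolds M K α c
  BodyHolds-mono J K J⊑K c (h , hs) = h , All.map (λ {A} → J⊑K (pred A)) hs

  consequences-mono : ∀ Φ J K → J ⊑ K → consequences M Φ J ⊑ consequences M Φ K
  consequences-mono Φ J K J⊑K p (c , Φc , xs , eq , α , b , v) =
    c , Φc , xs , eq , α , BodyHolds-mono J K J⊑K c b , v

  boundedSemantics-step : ∀ Φ n → boundedSemantics M Φ n ⊑ boundedSemantics M Φ (suc n)
  boundedSemantics-step Φ zero    = consequences-mono Φ (λ _ → ∅) (boundedSemantics M Φ 0) λ _ ()
  boundedSemantics-step Φ (suc n) = consequences-mono Φ _ _ (boundedSemantics-step Φ n)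

  module _ (J : ℕ → Interpretation {Π = Π} M) (step : ∀ n → J n ⊑ J (suc n)) where

    chain-mono′ : ∀ {m n} → m ≤′ n → J m ⊑ J n
    chain-mono′ ≤′-refl       p = id
    chain-mono′ (≤′-step m≤n) p = step _ p ∘ chain-mono′ m≤n p

    chain-mono : ∀ {m n} → m ≤ n → J m ⊑ J n
    chain-mono = chain-mono′ ∘ ≤⇒≤′

    -- A body has finitely many atoms, so the maximum of their stages serves all of them by
    -- monotonicity.
    atoms-bounded : ∀ {α As} → All (AtomHolds M (λ p v → ∃ λ n → J n p v) α) As → ∃ λ n → All (AtomHolds M (J n) α) As
    atoms-bounded []             = 0 , []
    atoms-bounded ((m , h) ∷ hs) =
      let n , ks = atoms-bounded hs in
      m ⊔ n , chain-mono (m≤m⊔n m n) _ h ∷ All.map (chain-mono (m≤n⊔m m n) _) ks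

    consequences-bounded : ∀ Φ → consequences M Φ (λ p v → ∃ λ n → J n p v) ⊑ λ p v → ∃ λ n → consequences M Φ (J n) p v
    consequences-bounded Φ p (c , Φc , xs , eq , α , (h , hs) , v) =
      let n , ks = atoms-bounded hs in n , c , Φc , xs , eq , α , (h , ks) , v

  -- Since bodies are finite, the union of the stages is a prefixed point of the consequence
  -- operator; rules can then be applied without tracking stages.
  semantics-closed : ∀ Φ → consequences M Φ (semantics M Φ) ⊑ semantics M Φ
  semantics-closed Φ p d =
    let n , e = consequences-bounded (boundedSemantics M Φ) (boundedSemantics-step Φ) Φ p d in suc n , e

-- Domain transformers

module _ (Z : DivisionByZero) (𝒟 : DomainTransformers) where
  open DomainTransformers 𝒟

  RepresentedAt : Assignment M-BV → Assignment (M-IA Z) → Var Σ-BV → Set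
  RepresentedAt α σ x = σ (x ′) ≡ δ x (α x)

  valuesAt-′ᵗ : ∀ {α σ ss} (xs : VarTuple Σ-BV ss) →
    (∀ {x} → x ∈ varsOf Σ-BV xs → RepresentedAt α σ x) →
    valuesAt (M-IA Z) σ (xs ′ᵗ) ≡ δᵗ xs (valuesAt M-BV α xs)
  valuesAt-′ᵗ []       r = refl
  valuesAt-′ᵗ (x ∷ xs) r = cong₂ _∷_ (r (here refl)) (valuesAt-′ᵗ xs (r ∘ there))

  valuesAt-′ᵗ⁻ : ∀ {α σ ss} (xs : VarTuple Σ-BV ss) →
    valuesAt (M-IA Z) σ (xs ′ᵗ) ≡ δᵗ xs (valuesAt M-BV α xs) →
    ∀ {x} → x ∈ varsOf Σ-BV xs → RepresentedAt α σ x
  valuesAt-′ᵗ⁻ (x ∷ xs) eq (here refl) = cong All.head eq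
  valuesAt-′ᵗ⁻ (x ∷ xs) eq (there x∈)  = valuesAt-′ᵗ⁻ xs (cong All.tail eq) x∈

  δᵗ-image-at : ∀ {σ ss} (xs : VarTuple Σ-BV ss) {v} → δᵗ xs v ≡ valuesAt (M-IA Z) σ (xs ′ᵗ) →
    ∀ {x} → x ∈ varsOf Σ-BV xs → Image (δ x) U (σ (x ′))
  δᵗ-image-at (x ∷ xs) {b ∷ v} eq (here refl) = b , tt , cong All.head eq
  δᵗ-image-at (x ∷ xs) {b ∷ v} eq (there x∈)  = δᵗ-image-at xs (cong All.tail eq) x∈

  δᵗ-injective : ∀ {ss} (xs : VarTuple Σ-BV ss) {u v} → δᵗ xs u ≡ δᵗ xs v → u ≡ v
  δᵗ-injective []       {[]}    {[]}    eq = refl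
  δᵗ-injective (x ∷ xs) {_ ∷ _} {_ ∷ _} eq =
    cong₂ _∷_ (δ-injective _ (cong All.head eq)) (δᵗ-injective xs (cong All.tail eq))

  δᵗ-cong : ∀ {ss} (xs ys : VarTuple Σ-BV ss) →
    (∀ {s} (i : s ∈ ss) b → δ (s , All.lookup xs i) b ≡ δ (s , All.lookup ys i) b) →
    ∀ v → δᵗ xs v ≡ δᵗ ys v
  δᵗ-cong []       []       eq []      = refl
  δᵗ-cong (x ∷ xs) (y ∷ ys) eq (b ∷ v) = cong₂ _∷_ (eq (here refl) b) (δᵗ-cong xs ys (eq ∘ there) v)

  -- As `prime` is a bijection, each integer variable is the copy of exactly one bit-vector
  -- variable, which makes this assignment total.
  represent : Assignment M-BV → Assignment (M-IA Z)
  represent α y = δ (Inverse.from prime y) (α (Inverse.from prime y))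

  represent-correct : ∀ α x → RepresentedAt α (represent α) x
  represent-correct α x = cong (λ z → δ z (α z)) (Inverse.strictlyInverseʳ prime x)

  choosePreimages : ∀ {σ} xs → (∀ {x} → x ∈ xs → Image (δ x) U (σ (x ′))) →
    Σ (Assignment M-BV) λ α → ∀ {x} → x ∈ xs → RepresentedAt α σ x
  choosePreimages {σ} xs im = (λ x → pick (x ∈? xs)) , λ {x} → pick-correct (x ∈? xs)
    where
    open DecMembership (≟-Var Σ-BV) using (_∈?_)

    pick : ∀ {x} → Dec (x ∈ xs) → Dom M-BV (proj₁ x)
    pick (yes x∈) = proj₁ (im x∈)
    -- An arbitrary default, as nothing is claimed outside `xs`.
    pick (no _)   = replicate _ false

    pick-correct : ∀ {x} (d : Dec (x ∈ xs)) → x ∈ xs → σ (x ′) ≡ δ x (pick d)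
    pick-correct (yes x∈) _  = sym (proj₂ (proj₂ (im x∈)))
    pick-correct (no x∉)  x∈ = contradiction x∈ x∉

  -- The theory transformer on single assignments

  module _ (𝒯 : TheoryTransformer Z 𝒟) where
    open TheoryTransformer 𝒯

    private
      agree-on-τ : ∀ φ {σ σ′ : Assignment (M-IA Z)} → (∀ {x} → x ∈ fv φ → σ (x ′) ≡ σ′ (x ′)) →
                   AgreeOn (M-IA Z) (fv (τ φ)) σ σ′
      agree-on-τ φ eq y∈ with ∈-map⁻ _′ (Equivalence.to (τ-fv φ) y∈)
      ... | x , x∈ , refl = eq x∈

      fv⇒varsOf : ∀ (φ : QF Σ-BV) {x} → x ∈ fv φ → x ∈ varsOf Σ-BV (asTuple Σ-BV (fv φ))
      fv⇒varsOf φ = subst (_ ∈_) (sym (varsOf-asTuple Σ-BV (fv φ)))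

      varsOf⇒fv : ∀ (φ : QF Σ-BV) {x} → x ∈ varsOf Σ-BV (asTuple Σ-BV (fv φ)) → x ∈ fv φ
      varsOf⇒fv φ = subst (_ ∈_) (varsOf-asTuple Σ-BV (fv φ))

    -- `τ-correct` compares sets of value tuples, so it yields only some assignment with the right
    -- values on `fv φ`. Truth depends on these values alone, and by `τ-fv` the variables of `τ φ`
    -- are copies of those of `φ`; hence the witness may be exchanged for `σ` or `α`.
    τ-Holds : ∀ {α σ} φ → (∀ {x} → x ∈ fv φ → RepresentedAt α σ x) → Holds M-BV α φ ⇔ Holds (M-IA Z) σ (τ φ)
    τ-Holds {α} {σ} φ r = mk⇔ to from
      where
      xs = asTuple Σ-BV (fv φ)

      to : Holds M-BV α φ → Holds (M-IA Z) σ (τ φ)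
      to h with proj₁ (τ-correct φ) (α , h , refl)
      ... | (σ′ , h′ , eq) , _ = Holds-cong (M-IA Z) (τ φ)
        (agree-on-τ φ λ x∈ → trans (valuesAt-′ᵗ⁻ xs eq (fv⇒varsOf φ x∈)) (sym (r x∈))) h′

      from : Holds (M-IA Z) σ (τ φ) → Holds M-BV α φ
      from h with proj₂ (τ-correct φ) ((σ , h , valuesAt-′ᵗ xs (r ∘ varsOf⇒fv φ)) , valuesAt M-BV α xs , tt , refl)
      ... | α′ , h′ , eq = Holds-cong M-BV φ (valuesAt-agree M-BV xs eq ∘ fv⇒varsOf φ) h′

-- The encoding

module _ {Π : PredSymbols Σ-BV} where

  rename-head⁻ : ∀ (H : Maybe (Atom Σ-BV Π)) {p xs} → Maybe.map renameAtom H ≡ just (copy p · xs) → H ≡ just (p · xs)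
  rename-head⁻ (just _) refl = refl

module _ (Z : DivisionByZero) {Π : PredSymbols Σ-BV} (Φ Δ : ClauseSet Σ-BV Π)
         (chc : ∀ {c} → Φ c → IsCHC c) (Δ⊆Φ : Δ ⊆ Φ)
         (𝒟 : DomainTransformers) (compatible : DomainTransformers.CompatibleWith 𝒟 Φ)
         (ℛ : DomainRestrictions Z 𝒟) (𝒯 : TheoryTransformer Z 𝒟) where
  open DomainTransformers 𝒟
  open DomainRestrictions ℛ
  open TheoryTransformer 𝒯

  private
    E = encode 𝒟 ℛ 𝒯 Φ Δ

    Δ-IA : ClauseSet Σ-BV Π
    Δ-IA c = Φ c × ¬ Δ c

    rename : Clause Σ-BV Π → Clause Σ-BV (copies Π BV)
    rename = renameClause

    translate : Clause Σ-BV Π → Clause Σ-IA (copies Π IA)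
    translate = translateClause 𝒟 ℛ 𝒯

    sem : Interpretation {Π = Π} M-BV
    sem = semantics M-BV Φ

    semᴱ : (a : Theory) → Interpretation {Π = copies Π a} (model Z a)
    semᴱ = semanticsᴱ Z 𝒟 Φ E

  -- Heads, applications and bodies under translation and renaming

  translate-head⁻ : ∀ (H : Maybe (Atom Σ-BV Π)) {p ws} → Maybe.map (translateAtom 𝒟 ℛ 𝒯) H ≡ just (copy p · ws) →
    ∃ λ xs → H ≡ just (p · xs) × xs ′ᵗ ≡ ws
  translate-head⁻ (just (p · xs)) refl = xs , refl , refl

  δᵗ-unique : ∀ {p xs ys} → ApplicationIn (p · xs) Φ → ApplicationIn (p · ys) Φ → ∀ v → δᵗ xs v ≡ δᵗ ys v
  δᵗ-unique {p} {xs} {ys} a b = δᵗ-cong Z 𝒟 xs ys (compatible p xs ys a b)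

  body⇒application : ∀ {c A} → Φ c → A ∈ body c → ApplicationIn A Φ
  body⇒application Φc A∈ = _ , Φc , inj₁ A∈

  head⇒application : ∀ {c A} → Φ c → head c ≡ just A → ApplicationIn A Φ
  head⇒application Φc eq = _ , Φc , inj₂ eq

  -- Under `represent` every variable lies in the image of its transformer, so all restrictions `ρ`
  -- hold. `J⇒K` is asked only for atoms of this body, because `Derivedᴱ` provides integer values
  -- only at body occurrences.
  translate-body : ∀ (J : Interpretation {Π = Π} M-BV) (K : Interpretation {Π = copies Π IA} (M-IA Z)) {α} c →
    (∀ {p xs} → (p · xs) ∈ body c → ∀ {v} → J p v → K (copy p) (δᵗ xs v)) →
    BodyHolds M-BV J α c → BodyHolds (M-IA Z) K (represent Z 𝒟 α) (translate c)
  translate-body J K {α} c J⇒K (h , hs) =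
    (Equivalence.to (τ-Holds Z 𝒟 𝒯 (constraint c) (λ {x} _ → represent-correct Z 𝒟 α x)) h ,
     Holds-⋀⁺ (M-IA Z) (map ρ (nonBodyVars (vars c) (body c))) (All.map⁺ (All.tabulate λ {x} _ →
       Equivalence.from (ρ-correct x (represent Z 𝒟 α)) (α x , tt , sym (represent-correct Z 𝒟 α x))))) ,
    All.map⁺ (All.tabulate λ {A} A∈ →
      subst (K (copy (pred A))) (sym (valuesAt-′ᵗ Z 𝒟 (args A) λ {x} _ → represent-correct Z 𝒟 α x))
        (J⇒K A∈ (All.lookup hs A∈)))

  -- Preimages are chosen variable by variable. The constraint transfers because its free variables
  -- are among `vars c`, and the atoms because `δᵗ` is injective. The last component allows the head
  -- to be transferred as well.
  translate-body⁻ : ∀ (J : Interpretation {Π = Π} M-BV) (K : Interpretation {Π = copies Π IA} (M-IA Z)) {σ c} → Φ c →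
    (∀ p → K (copy p) ⊆ δₚ-image Φ p (J p)) →
    BodyHolds (M-IA Z) K σ (translate c) →
    Σ (Assignment M-BV) λ α → BodyHolds M-BV J α c × (∀ {x} → x ∈ vars c → RepresentedAt Z 𝒟 α σ x)
  translate-body⁻ J K {σ} {c} Φc K⇒J ((h , hρ) , hs) =
    α , (Equivalence.from (τ-Holds Z 𝒟 𝒯 (constraint c) (r ∘ Equivalence.from constraint-vars)) h ,
         All.tabulate atomHolds) , r
    where
    open IsCHC (chc Φc)
    open DecMembership (≟-Var Σ-BV) using (_∈?_)

    atomValue : ∀ {A} → A ∈ body c → ∃ λ v → J (pred A) v × δᵗ (args A) v ≡ valuesAt (M-IA Z) σ (args A ′ᵗ)
    atomValue {A} A∈ with K⇒J (pred A) (All.lookup (All.map⁻ hs) A∈)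
    -- The value comes with the arguments `ys` of some application; compatibility replaces them by
    -- those of `A`.
    ... | ys , pxs , v , Jv , eq = v , Jv , trans (δᵗ-unique (body⇒application Φc A∈) pxs v) eq

    inImage : ∀ {x} → x ∈ vars c → Image (δ x) U (σ (x ′))
    inImage {x} x∈ with x ∈? concatMap (varsOf Σ-BV ∘ args) (body c)
    ... | no x∉ = Equivalence.to (ρ-correct x σ)
                    (All.lookup (All.map⁻ (Holds-⋀⁻ (M-IA Z) _ hρ)) (∈-filter⁺ _ x∈ x∉))
    ... | yes x∈B with find (∈-concatMap⁻ (varsOf Σ-BV ∘ args) {xs = body c} x∈B)
    ...   | A , A∈ , x∈A = δᵗ-image-at Z 𝒟 (args A) (proj₂ (proj₂ (atomValue A∈))) x∈A

    chosen = choosePreimages Z 𝒟 {σ} (vars c) inImage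
    α = proj₁ chosen

    r : ∀ {x} → x ∈ vars c → RepresentedAt Z 𝒟 α σ x
    r = proj₂ chosen

    atomHolds : ∀ {A} → A ∈ body c → AtomHolds M-BV J α A
    atomHolds {A} A∈ with atomValue A∈
    ... | v , Jv , eq =
      -- Both `v` and the values under `α` are mapped to the tuple read off from `σ`, so they
      -- coincide.
      subst (J (pred A)) (δᵗ-injective Z 𝒟 (args A) (trans eq (valuesAt-′ᵗ Z 𝒟 (args A) (r ∘ body-vars A∈)))) Jv

  rename-body : ∀ (J : Interpretation {Π = Π} M-BV) (K : Interpretation {Π = copies Π BV} M-BV) {α} c →
    (∀ {A} → A ∈ body c → J (pred A) ⊆ K (copy (pred A))) →
    BodyHolds M-BV J α c → BodyHolds M-BV K α (rename c)
  rename-body J K c J⇒K (h , hs) = h , All.map⁺ (All.tabulate λ A∈ → J⇒K A∈ (All.lookup hs A∈))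

  rename-body⁻ : ∀ (J : Interpretation {Π = Π} M-BV) (K : Interpretation {Π = copies Π BV} M-BV) {α} c →
    (∀ p → K (copy p) ⊆ J p) →
    BodyHolds M-BV K α (rename c) → BodyHolds M-BV J α c
  rename-body⁻ J K c K⇒J (h , hs) = h , All.map (λ {A} → K⇒J (pred A)) (All.map⁻ hs)

  -- Monotonicity and closure of the semantics of the encoding

  boundedᴱ-step : ∀ n a p → boundedᴱ Z 𝒟 Φ E n a p ⊆ boundedᴱ Z 𝒟 Φ E (suc n) a p
  boundedᴱ-step zero a p (inj₁ d) =
    inj₁ (consequences-mono (model Z a) (Encoding.clauses E a) (λ _ → ∅) (boundedᴱ Z 𝒟 Φ E 0 a) (λ _ ()) p d)
  boundedᴱ-step (suc n) a p (inj₁ d) =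
    inj₁ (consequences-mono (model Z a) (Encoding.clauses E a) _ _ (boundedᴱ-step n a) p d)
  boundedᴱ-step (suc n) BV p (inj₂ (i , xs , pxs , d)) =
    inj₂ (i , xs , pxs , boundedᴱ-step n IA _ d)
  boundedᴱ-step (suc n) IA p (inj₂ (i , xs , pxs , v , d , eq)) =
    inj₂ (i , xs , pxs , v , boundedᴱ-step n BV _ d , eq)

  semanticsᴱ-closed : ∀ a p → consequences (model Z a) (Encoding.clauses E a) (semᴱ a) p ⊆ semᴱ a p
  semanticsᴱ-closed a p d =
    let n , e = consequences-bounded (model Z a) (λ n → boundedᴱ Z 𝒟 Φ E n a) (λ n → boundedᴱ-step n a)
                  (Encoding.clauses E a) p d
    in suc n , inj₁ e

  -- Soundness: from derivations in the encoding to derivations in `Φ`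

  sound-local-BV : ∀ K → (∀ p → K (copy p) ⊆ sem p) →
    ∀ p → consequences M-BV (Encoding.clauses E BV) K (copy p) ⊆ sem p
  sound-local-BV K K⇒ p (_ , (c , Δc , refl) , xs , eq , α , b , v) =
    semantics-closed M-BV Φ p (c , Δ⊆Φ Δc , xs , rename-head⁻ (head c) eq , α , rename-body⁻ sem K c K⇒ b , v)

  sound-local-IA : ∀ K → (∀ p → K (copy p) ⊆ δₚ-image Φ p (sem p)) →
    ∀ p → consequences (M-IA Z) (Encoding.clauses E IA) K (copy p) ⊆ δₚ-image Φ p (sem p)
  sound-local-IA K K⇒ p (_ , (c , (Φc , _) , refl) , ws , eq , σ , b , refl)
    with translate-head⁻ (head c) eq | translate-body⁻ sem K Φc K⇒ b
  ... | xs , heq , refl | α , b′ , r =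
    xs , head⇒application Φc heq , valuesAt M-BV α xs ,
    semantics-closed M-BV Φ p (c , Φc , xs , heq , α , b′ , refl) ,
    sym (valuesAt-′ᵗ Z 𝒟 xs (r ∘ IsCHC.head-vars (chc Φc) heq))

  mutual
    -- Joint induction on the stage, as the external part of one theory reads the previous stage of
    -- the other. The integer invariant also asserts that every derived tuple is an image, which
    -- `translate-body⁻` requires.
    sound-BV : ∀ n p → boundedᴱ Z 𝒟 Φ E n BV (copy p) ⊆ sem p
    sound-BV zero    p (inj₁ d) = sound-local-BV (λ _ → ∅) (λ _ ()) p d
    sound-BV (suc n) p (inj₁ d) = sound-local-BV (boundedᴱ Z 𝒟 Φ E n BV) (sound-BV n) p d
    sound-BV (suc n) p (inj₂ (_ , xs , pxs , d)) with sound-IA n p d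
    ... | ys , pxs′ , u , s , eq =
      subst (sem p) (δᵗ-injective Z 𝒟 xs (trans (δᵗ-unique pxs pxs′ u) eq)) s

    sound-IA : ∀ n p → boundedᴱ Z 𝒟 Φ E n IA (copy p) ⊆ δₚ-image Φ p (sem p)
    sound-IA zero    p (inj₁ d) = sound-local-IA (λ _ → ∅) (λ _ ()) p d
    sound-IA (suc n) p (inj₁ d) = sound-local-IA (boundedᴱ Z 𝒟 Φ E n IA) (sound-IA n) p d
    sound-IA (suc n) p (inj₂ (_ , xs , pxs , v , d , eq)) = xs , pxs , v , sound-BV n p d , eq

  -- Completeness: from derivations in `Φ` to derivations in the encoding

  -- `I` passes `p` on only to a theory in whose bodies it occurs, so a value is required only
  -- there. The integer part ranges over the occurrences because `δ_p` is read off from the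
  -- arguments of an application.
  Derivedᴱ : Interpretation {Π = Π} M-BV
  Derivedᴱ p v =
    (OccursInBodyIn p Δ → semᴱ BV (copy p) v) ×
    (∀ {c xs} → Δ-IA c → (p · xs) ∈ body c → semᴱ IA (copy p) (δᵗ xs v))

  complete-body-BV : ∀ {α c} → Δ c → BodyHolds M-BV Derivedᴱ α c → BodyHolds M-BV (semᴱ BV) α (rename c)
  complete-body-BV {c = c} Δc = rename-body Derivedᴱ (semᴱ BV) c λ A∈ D → proj₁ D (c , Δc , _ , A∈)

  complete-body-IA : ∀ {α c} → Δ-IA c → BodyHolds M-BV Derivedᴱ α c →
    BodyHolds (M-IA Z) (semᴱ IA) (represent Z 𝒟 α) (translate c)
  complete-body-IA {c = c} Δc = translate-body Derivedᴱ (semᴱ IA) c λ A∈ D → proj₂ D Δc A∈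

  -- The rule is applied in the theory that owns it. Its head and a body occurrence of `p` in the
  -- other theory are exactly the two conditions for membership in `I`, so the value is passed on.
  complete-rule : ∀ {α c p xs} → Φ c → Dec (Δ c) → head c ≡ just (p · xs) →
    BodyHolds M-BV Derivedᴱ α c → Derivedᴱ p (valuesAt M-BV α xs)
  complete-rule {α} {c} {p} {xs} Φc (yes Δc) eq b = (λ _ → derived) , passedOn
    where
    headEq : head (rename c) ≡ just (copy p · xs)
    headEq = cong (Maybe.map renameAtom) eq

    derived : semᴱ BV (copy p) (valuesAt M-BV α xs)
    derived = semanticsᴱ-closed BV (copy p)
      (rename c , (c , Δc , refl) , xs , headEq , α , complete-body-BV Δc b , refl)

    passedOn : ∀ {d ys} → Δ-IA d → (p · ys) ∈ body d → semᴱ IA (copy p) (δᵗ ys (valuesAt M-BV α xs))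
    passedOn {d} {ys} Δd A∈ =
      -- One stage later, since the external part reads the preceding stage of the other theory.
      suc (proj₁ derived) ,
      inj₂ (I-BV p (rename c , (c , Δc , refl) , xs , headEq)
                   (translate d , (d , Δd , refl) , ys ′ᵗ , ∈-map⁺ (translateAtom 𝒟 ℛ 𝒯) A∈) ,
            ys , body⇒application (proj₁ Δd) A∈ , _ , proj₂ derived , refl)
  complete-rule {α} {c} {p} {xs} Φc (no ¬Δc) eq b = passedOn , λ Δd A∈ →
    -- The tuple is derived with the transformers of the head variables but needed with those of a
    -- body occurrence; compatibility equates them.
    subst (semᴱ IA (copy p)) (δᵗ-unique (head⇒application Φc eq) (body⇒application (proj₁ Δd) A∈) _) derived
    where
    headEq : head (translate c) ≡ just (copy p · (xs ′ᵗ))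
    headEq = cong (Maybe.map (translateAtom 𝒟 ℛ 𝒯)) eq

    derived : semᴱ IA (copy p) (δᵗ xs (valuesAt M-BV α xs))
    derived = semanticsᴱ-closed IA (copy p)
      (translate c , (c , (Φc , ¬Δc) , refl) , xs ′ᵗ , headEq , represent Z 𝒟 α , complete-body-IA (Φc , ¬Δc) b ,
       valuesAt-′ᵗ Z 𝒟 xs λ {x} _ → represent-correct Z 𝒟 α x)

    passedOn : OccursInBodyIn p Δ → semᴱ BV (copy p) (valuesAt M-BV α xs)
    passedOn (d , Δd , ys , A∈) =
      suc (proj₁ derived) ,
      inj₂ (I-IA p (translate c , (c , (Φc , ¬Δc) , refl) , xs ′ᵗ , headEq)
                   (rename d , (d , Δd , refl) , ys , ∈-map⁺ renameAtom A∈) ,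
            xs , head⇒application Φc eq , proj₂ derived)

  ¬¬-body : ∀ J {α} c → (∀ p {v} → J p v → ¬ ¬ Derivedᴱ p v) →
    BodyHolds M-BV J α c → ¬ ¬ BodyHolds M-BV Derivedᴱ α c
  ¬¬-body J c J⇒ (h , hs) k = ¬¬-All (All.map (λ {A} → J⇒ (pred A)) hs) λ ks → k (h , ks)

  -- Which theory owns the last rule is decided under a double negation, and the finitely many
  -- double negations of the body atoms are merged into one.
  complete-consequences : ∀ J → (∀ p {v} → J p v → ¬ ¬ Derivedᴱ p v) →
    ∀ p {v} → consequences M-BV Φ J p v → ¬ ¬ Derivedᴱ p v
  complete-consequences J J⇒ p (c , Φc , xs , eq , α , b , refl) k =
    ¬¬-excluded-middle λ Δc? → ¬¬-body J c J⇒ b λ b′ → k (complete-rule Φc Δc? eq b′)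

  complete : ∀ n p {v} → boundedSemantics M-BV Φ n p v → ¬ ¬ Derivedᴱ p v
  complete zero    = complete-consequences (λ _ → ∅) λ _ ()
  complete (suc n) = complete-consequences (boundedSemantics M-BV Φ n) (complete n)

  -- The two implications between the satisfiability notions

  satisfiable⇒satisfiableᴱ : Satisfiable M-BV Φ → Satisfiableᴱ Z 𝒟 Φ E
  satisfiable⇒satisfiableᴱ sat BV _ (c , Δc , refl) eq α b =
    sat c (Δ⊆Φ Δc) (map-nothing⁻ (head c) eq) α (rename-body⁻ sem (semᴱ BV) c (λ p (n , d) → sound-BV n p d) b)
  satisfiable⇒satisfiableᴱ sat IA _ (c , (Φc , _) , refl) eq σ b =
    let α , b′ , _ = translate-body⁻ sem (semᴱ IA) Φc (λ p (n , d) → sound-IA n p d) b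
    in sat c Φc (map-nothing⁻ (head c) eq) α b′

  satisfiableᴱ⇒satisfiable : Satisfiableᴱ Z 𝒟 Φ E → Satisfiable M-BV Φ
  satisfiableᴱ⇒satisfiable sat c Φc eq α b =
    -- The goal is `⊥`, so the doubly negated facts about `Δ c` and the body may be used as if they
    -- held.
    ¬¬-excluded-middle λ Δc? → ¬¬-body sem c (λ p (n , d) → complete n p d) b (refute Δc?)
    where
    refute : Dec (Δ c) → ¬ BodyHolds M-BV Derivedᴱ α c
    refute (yes Δc) b′ = sat BV (rename c) (c , Δc , refl) (cong (Maybe.map renameAtom) eq) α
      (complete-body-BV Δc b′)
    refute (no ¬Δc) b′ = sat IA (translate c) (c , (Φc , ¬Δc) , refl) (cong (Maybe.map (translateAtom 𝒟 ℛ 𝒯)) eq)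
      (represent Z 𝒟 α) (complete-body-IA (Φc , ¬Δc) b′)

theorem1 : (Z : DivisionByZero) (Π : PredSymbols Σ-BV) (Φ Δ : ClauseSet Σ-BV Π) →
    (∀ {c} → Φ c → IsCHC c) →
    Δ ⊆ Φ →
    (𝒟 : DomainTransformers) → DomainTransformers.CompatibleWith 𝒟 Φ →
    (ℛ : DomainRestrictions Z 𝒟) (𝒯 : TheoryTransformer Z 𝒟) →
    Satisfiable M-BV Φ ⇔ Satisfiableᴱ Z 𝒟 Φ (encode 𝒟 ℛ 𝒯 Φ Δ)
theorem1 Z Π Φ Δ chc Δ⊆Φ 𝒟 compatible ℛ 𝒯 = mk⇔
  (satisfiable⇒satisfiableᴱ Z Φ Δ chc Δ⊆Φ 𝒟 compatible ℛ 𝒯)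
  (satisfiableᴱ⇒satisfiable Z Φ Δ chc Δ⊆Φ 𝒟 compatible ℛ 𝒯)
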